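{- Every 3-layered DAG $G = (V = V_1 \cup V_2 \cup V_3, E,w)$ with positive edge weights and $|V_2| = 2$ has a shortest-paths preserver $H = (V,E,w_H)$ all of whose edge weights are integers in the range $\{1,2,\dots, |V_1| + |V_3| + 1\}$.
   Context: Graphs are finite. A 3-layered DAG is a directed graph whose vertex set is a disjoint union $V = V_1 \cup V_2 \cup V_3$ and all of whose edges go from $V_1$ to $V_2$ or from $V_2$ to $V_3$. Edge weights $w$ are positive reals; the weight of a path is the sum of the weights of its edges; a shortest path is a directed path of minimum weight between its endpoints. Given $G=(V,E,w)$, a graph $H=(V,E,w_H)$ on the same vertex and edge set with positive edge weights $w_H$ is a shortest-paths preserver of $G$ if every shortest path $\pi$ in $H$ is (as a sequence of vertices and edges) also a shortest path in $G$. -}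

module Defs where

open import Data.Bool using (Bool; T)
open import Data.Fin using (Fin)
open import Data.Integer using (+_)
import Data.Nat as ℕ
open ℕ using (ℕ)
import Data.Nat.Properties as ℕₚ
open import Data.Product using (∃-syntax; _×_; _,_; proj₁; proj₂)
open import Data.Rational as ℚ using (ℚ; 0ℚ; ½; ∣_∣)
import Data.Rational.Properties as ℚₚ
open import Data.Rational.Solver using (module +-*-Solver)
open import Data.Sum using (_⊎_; inj₁; inj₂)
open import Relation.Binary.Construct.Closure.ReflexiveTransitive using (Star; ε; _◅_)
open import Relation.Binary.PropositionalEquality using (_≡_; refl; sym; trans; cong; subst)

-- Real numbers: Cauchy sequences of rationals, with equality _≃_ of limits.

IsCauchy : (ℕ → ℚ) → Set
IsCauchy s = ∀ δ → 0ℚ ℚ.< δ →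
  ∃[ N ] (∀ m n → N ℕ.≤ m → N ℕ.≤ n → ∣ s m ℚ.- s n ∣ ℚ.< δ)

record ℝ : Set where
  constructor mkℝ
  field
    seq    : ℕ → ℚ
    cauchy : IsCauchy seq

open ℝ public

infix 4 _≃_ _≤ᴿ_ _<ᴿ_
infixl 6 _+ᴿ_

_≃_ : ℝ → ℝ → Set
x ≃ y = ∀ δ → 0ℚ ℚ.< δ →
  ∃[ N ] (∀ n → N ℕ.≤ n → ∣ seq x n ℚ.- seq y n ∣ ℚ.< δ)

-- The limits are separated by a positive rational gap.
_<ᴿ_ : ℝ → ℝ → Set
x <ᴿ y = ∃[ δ ] (0ℚ ℚ.< δ × ∃[ N ] (∀ n → N ℕ.≤ n → seq x n ℚ.+ δ ℚ.≤ seq y n))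

-- The slack δ is needed because x ≤ y in the limit does not give
-- seq x n ≤ seq y n for any n.
_≤ᴿ_ : ℝ → ℝ → Set
x ≤ᴿ y = ∀ δ → 0ℚ ℚ.< δ →
  ∃[ N ] (∀ n → N ℕ.≤ n → seq x n ℚ.≤ seq y n ℚ.+ δ)

fromℚ : ℚ → ℝ
fromℚ q = mkℝ (λ _ → q) λ δ 0<δ → 0 , λ _ _ _ _ →
  subst (ℚ._< δ) (sym (cong ∣_∣ (ℚₚ.+-inverseʳ q))) 0<δ

fromℕ : ℕ → ℝ
fromℕ k = fromℚ (+ k ℚ./ 1)

0ᴿ : ℝ
0ᴿ = fromℕ 0

_+ᴿ_ : ℝ → ℝ → ℝ
seq    (x +ᴿ y) n = seq x n ℚ.+ seq y n
cauchy (x +ᴿ y) δ 0<δ = N₁ ℕ.⊔ N₂ , λ m n N≤m N≤n →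
  subst (∣ (seq x m ℚ.+ seq y m) ℚ.- (seq x n ℚ.+ seq y n) ∣ ℚ.<_) half+half
    (ℚₚ.≤-<-trans
      (subst (λ z → ∣ z ∣ ℚ.≤ ∣ seq x m ℚ.- seq x n ∣ ℚ.+ ∣ seq y m ℚ.- seq y n ∣)
        (regroup (seq x m) (seq x n) (seq y m) (seq y n))
        (ℚₚ.∣p+q∣≤∣p∣+∣q∣ (seq x m ℚ.- seq x n) (seq y m ℚ.- seq y n)))
      (ℚₚ.+-mono-<
        (bound₁ m n (ℕₚ.≤-trans (ℕₚ.m≤m⊔n N₁ N₂) N≤m) (ℕₚ.≤-trans (ℕₚ.m≤m⊔n N₁ N₂) N≤n))
        (bound₂ m n (ℕₚ.≤-trans (ℕₚ.m≤n⊔m N₁ N₂) N≤m) (ℕₚ.≤-trans (ℕₚ.m≤n⊔m N₁ N₂) N≤n))))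
  where
  η : ℚ
  η = ½ ℚ.* δ

  0<η : 0ℚ ℚ.< η
  0<η = subst (ℚ._< η) (ℚₚ.*-zeroʳ ½) (ℚₚ.*-monoʳ-<-pos ½ 0<δ)

  half+half : η ℚ.+ η ≡ δ
  half+half = trans (sym (ℚₚ.*-distribʳ-+ δ ½ ½)) (ℚₚ.*-identityˡ δ)

  regroup : ∀ a b c d → (a ℚ.- b) ℚ.+ (c ℚ.- d) ≡ (a ℚ.+ c) ℚ.- (b ℚ.+ d)
  regroup = solve 4 (λ a b c d → (a :- b) :+ (c :- d) := (a :+ c) :- (b :+ d)) refl
    where open +-*-Solver

  N₁ N₂ : ℕ
  N₁ = proj₁ (cauchy x η 0<η)
  N₂ = proj₁ (cauchy y η 0<η)

  bound₁ : ∀ m n → N₁ ℕ.≤ m → N₁ ℕ.≤ n → ∣ seq x m ℚ.- seq x n ∣ ℚ.< η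
  bound₁ = proj₂ (cauchy x η 0<η)

  bound₂ : ∀ m n → N₂ ℕ.≤ m → N₂ ℕ.≤ n → ∣ seq y m ℚ.- seq y n ∣ ℚ.< η
  bound₂ = proj₂ (cauchy y η 0<η)

record Digraph : Set₁ where
  field
    Vertex   : Set
    adjacent : Vertex → Vertex → Bool

  -- At most one proof, so there are no parallel edges.
  Edge : Vertex → Vertex → Set
  Edge u v = T (adjacent u v)

  -- Directed walks, including the empty one at each vertex; in an acyclic
  -- graph these are exactly the directed paths.
  Path : Vertex → Vertex → Set
  Path = Star Edge

  record Weighting : Set where
    field
      weight   : ∀ u v → Edge u v → ℝ
      positive : ∀ u v (e : Edge u v) → 0ᴿ <ᴿ weight u v e

  open Weighting public

  pathWeight : Weighting → ∀ {u v} → Path u v → ℝ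
  pathWeight w ε                   = 0ᴿ
  pathWeight w (_◅_ {u} {v} e π) = weight w u v e +ᴿ pathWeight w π

  IsShortest : Weighting → ∀ {u v} → Path u v → Set
  IsShortest w {u} {v} π = (π′ : Path u v) → pathWeight w π ≤ᴿ pathWeight w π′

  -- IsPreserver w w-H: the graph weighted by w-H is a shortest-paths
  -- preserver of the graph weighted by w.
  IsPreserver : Weighting → Weighting → Set
  IsPreserver w w-H = ∀ {u v} (π : Path u v) → IsShortest w-H π → IsShortest w π

  IntegerWeightsIn[1,_] : ℕ → Weighting → Set
  IntegerWeightsIn[1, M ] w = ∀ u v (e : Edge u v) →
    ∃[ k ] (1 ℕ.≤ k × k ℕ.≤ M × weight w u v e ≃ fromℕ k)

-- The layer sizes |V₁|, |V₂|, |V₃| are n₁, n₂, n₃.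
LayeredVertex : ℕ → ℕ → ℕ → Set
LayeredVertex n₁ n₂ n₃ = Fin n₁ ⊎ Fin n₂ ⊎ Fin n₃

data NextLayer {n₁ n₂ n₃ : ℕ} : (u v : LayeredVertex n₁ n₂ n₃) → Set where
  V₁→V₂ : ∀ s m → NextLayer (inj₁ s) (inj₂ (inj₁ m))
  V₂→V₃ : ∀ m t → NextLayer (inj₂ (inj₁ m)) (inj₂ (inj₂ t))

record ThreeLayeredDAG (n₁ n₂ n₃ : ℕ) : Set where
  field
    adj     : LayeredVertex n₁ n₂ n₃ → LayeredVertex n₁ n₂ n₃ → Bool
    layered : ∀ u v → T (adj u v) → NextLayer u v

  digraph : Digraph
  digraph = record { Vertex = LayeredVertex n₁ n₂ n₃ ; adjacent = adj }

  open Digraph digraph public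

{-# OPTIONS --safe #-}
module Submission where

-- A two-edge path s → a → t is lighter than s → b → t exactly when
-- w(s,a) - w(s,b) < w(b,t) - w(a,t). So only the relative order of the numbers
-- w(s,a) - w(s,b) and w(b,t) - w(a,t) matters, and these |V₁| + |V₃| numbers may be
-- replaced by their ranks: H gives s → a the weight 1 + rank of s, b → t the weight
-- 1 + rank of t, and every other edge the weight 1. Strict inequalities between path
-- weights in G then persist in H.

open import Defs
open import Axiom.ExcludedMiddle using (ExcludedMiddle)
open import Data.Bool.Properties using (T-irrelevant; T?)
open import Data.Empty using (⊥-elim)
open import Data.Fin using (Fin; zero; suc; join; splitAt)
open import Data.Fin.Properties using (splitAt-join)
open import Data.Fin.Subset using (Subset; ∣_∣; _∈_)
open import Data.Fin.Subset.Properties using (∣p∣≤n; p⊂q⇒∣p∣<∣q∣)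
import Data.Integer as ℤ
import Data.Integer.Properties as ℤₚ
open import Data.Nat using (ℕ; _+_)
import Data.Nat as ℕ
import Data.Nat.Coprimality as Coprimality
import Data.Nat.Properties as ℕₚ
open import Data.Product using (∃-syntax; _×_; _,_; proj₁)
open import Data.Rational as ℚ using (0ℚ; 1ℚ; ½)
import Data.Rational.Properties as ℚₚ
open import Data.Rational.Solver using (module +-*-Solver)
open import Data.Sum using (_⊎_; inj₁; inj₂)
open import Data.Vec using (tabulate)
open import Data.Vec.Properties using (lookup∘tabulate; []=⇒lookup; lookup⇒[]=)
open import Level using (0ℓ)
open import Relation.Binary.Construct.Closure.ReflexiveTransitive using (ε; _◅_)
open import Relation.Binary.Core using (Rel)
open import Relation.Binary.Definitions using (Decidable; Irreflexive; Transitive)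
open import Relation.Binary.PropositionalEquality
  using (_≡_; refl; sym; trans; cong; cong₂; subst; subst₂)
open import Relation.Nullary using (¬_; does; yes; no)
open import Relation.Nullary.Decidable using (dec-true; toWitness)

-- Ranks of elements in a strict order.

module Rank {A : Set} {_≺_ : Rel A 0ℓ} (≺-irrefl : Irreflexive _≡_ _≺_)
            (≺-trans : Transitive _≺_) (_≺?_ : Decidable _≺_)
            {n : ℕ} (f : Fin n → A) where

  below : A → Subset n
  below a = tabulate λ i → does (f i ≺? a)

  rank : A → ℕ
  rank a = ∣ below a ∣

  ∈-below⁺ : ∀ {a} i → f i ≺ a → i ∈ below a
  ∈-below⁺ {a} i fi≺a = lookup⇒[]= i (below a)
    (trans (lookup∘tabulate _ i) (dec-true (f i ≺? a) fi≺a))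

  ∈-below⁻ : ∀ {a} i → i ∈ below a → f i ≺ a
  ∈-below⁻ {a} i i∈ with f i ≺? a
                       | trans (sym (lookup∘tabulate (λ j → does (f j ≺? a)) i)) ([]=⇒lookup i∈)
  ... | yes fi≺a | _ = fi≺a

  rank≤n : ∀ a → rank a ℕ.≤ n
  rank≤n a = ∣p∣≤n (below a)

  -- Transitivity puts `below (f i)` inside `below a`. The inclusion is proper because `i` lies in
  -- the second set and, by irreflexivity, not in the first, so the cardinalities differ strictly.
  rank-strict : ∀ i {a} → f i ≺ a → rank (f i) ℕ.< rank a
  rank-strict i fi≺a = p⊂q⇒∣p∣<∣q∣
    ( (λ {j} j∈ → ∈-below⁺ j (≺-trans (∈-below⁻ j j∈) fi≺a))
    , i , ∈-below⁺ i fi≺a , λ i∈ → ≺-irrefl refl (∈-below⁻ i i∈))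

-- Order on rationals and on Cauchy reals.

fromℕ-homo-+ : ∀ a b → (ℤ.+ a ℚ./ 1) ℚ.+ (ℤ.+ b ℚ./ 1) ≡ ℤ.+ (a + b) ℚ./ 1
fromℕ-homo-+ a b = trans (cong₂ ℚ._+_ (reduced a) (reduced b))
  (ℚₚ./-cong (cong₂ ℤ._+_ (ℤₚ.*-identityʳ (ℤ.+ a)) (ℤₚ.*-identityʳ (ℤ.+ b))) refl)
  where
  reduced : ∀ k → ℤ.+ k ℚ./ 1 ≡ ℚ.mkℚ (ℤ.+ k) 0 _
  -- The gcd inside `ℚ./` is stuck on a variable `k`; in this normal form addition computes.
  reduced k = ℚₚ.normalize-coprime (Coprimality.sym (Coprimality.1-coprimeTo k))

fromℕ-mono-≤ : ∀ {a b} → a ℕ.≤ b → ℤ.+ a ℚ./ 1 ℚ.≤ ℤ.+ b ℚ./ 1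
fromℕ-mono-≤ {a} a≤b with ℕₚ.m≤n⇒∃[o]m+o≡n a≤b
... | o , refl = subst₂ ℚ._≤_ (ℚₚ.+-identityʳ _) (fromℕ-homo-+ a o)
  (ℚₚ.+-monoʳ-≤ (ℤ.+ a ℚ./ 1)
    (ℚₚ.nonNegative⁻¹ (ℤ.+ o ℚ./ 1) {{ℚₚ.normalize-nonNeg o 1}}))

half : ∀ δ → 0ℚ ℚ.< δ → ∃[ η ] (0ℚ ℚ.< η × η ℚ.+ η ≡ δ)
half δ 0<δ = ½ ℚ.* δ
  , subst (ℚ._< ½ ℚ.* δ) (ℚₚ.*-zeroʳ ½) (ℚₚ.*-monoʳ-<-pos ½ 0<δ)
  , trans (sym (ℚₚ.*-distribʳ-+ δ ½ ½)) (ℚₚ.*-identityˡ δ)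

p≤∣p∣ : ∀ p → p ℚ.≤ ℚ.∣ p ∣
p≤∣p∣ p with ℚₚ.≤-total 0ℚ p
... | inj₁ 0≤p = ℚₚ.≤-reflexive (sym (ℚₚ.0≤p⇒∣p∣≡p 0≤p))
... | inj₂ p≤0 = ℚₚ.≤-trans p≤0 (ℚₚ.0≤∣p∣ p)

∣p-q∣<r⇒p≤q+r : ∀ p q {r} → ℚ.∣ p ℚ.- q ∣ ℚ.< r → p ℚ.≤ q ℚ.+ r
∣p-q∣<r⇒p≤q+r p q ∣p-q∣<r = subst (ℚ._≤ _) (q+[p-q]≡p p q)
  (ℚₚ.+-monoʳ-≤ q (ℚₚ.≤-trans (p≤∣p∣ (p ℚ.- q)) (ℚₚ.<⇒≤ ∣p-q∣<r)))
  where
  q+[p-q]≡p : ∀ p q → q ℚ.+ (p ℚ.- q) ≡ p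
  q+[p-q]≡p = solve 2 (λ p q → q :+ (p :- q) := p) refl
    where open +-*-Solver

+-cancelʳ-≤ : ∀ r {p q} → p ℚ.+ r ℚ.≤ q ℚ.+ r → p ℚ.≤ q
+-cancelʳ-≤ r {p} {q} p+r≤q+r =
  subst₂ ℚ._≤_ (p+r-r≡p p r) (p+r-r≡p q r) (ℚₚ.+-monoˡ-≤ (ℚ.- r) p+r≤q+r)
  where
  p+r-r≡p : ∀ p r → p ℚ.+ r ℚ.- r ≡ p
  p+r-r≡p = solve 2 (λ p r → p :+ r :- r := p) refl
    where open +-*-Solver

0<q⇒p<p+q : ∀ p {q} → 0ℚ ℚ.< q → p ℚ.< p ℚ.+ q
0<q⇒p<p+q p 0<q = subst (ℚ._< p ℚ.+ _) (ℚₚ.+-identityʳ p) (ℚₚ.+-monoʳ-< p 0<q)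

-- Taking half of the gap `δ` as slack gives `y + δ ≤ x ≤ y + η` at an index past both thresholds,
-- although `η < δ`.
≤ᴿ⇒≯ᴿ : ∀ x y → x ≤ᴿ y → ¬ (y <ᴿ x)
≤ᴿ⇒≯ᴿ x y x≤y (δ , 0<δ , N , y+δ≤x) with half δ 0<δ
... | η , 0<η , refl with x≤y η 0<η
... | N′ , x≤y+η = ℚₚ.<-irrefl refl
  (ℚₚ.<-≤-trans (ℚₚ.+-monoʳ-< (seq y n) (0<q⇒p<p+q η 0<η))
    (ℚₚ.≤-trans (y+δ≤x n (ℕₚ.m≤m⊔n N N′)) (x≤y+η n (ℕₚ.m≤n⊔m N N′))))
  where
  n = N ℕ.⊔ N′

-- Comparison of rationals is decidable, so a failure of the bound may be assumed at a single index
-- `n`. The Cauchy property spreads it to all later `m`: of the excess `δ = 4θ`, each sequence may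
-- lose `θ` by oscillation, and `η = 2θ` remains as a uniform gap, contradicting `y≮x`.
≯ᴿ⇒≤ᴿ : ∀ x y → ¬ (y <ᴿ x) → x ≤ᴿ y
≯ᴿ⇒≤ᴿ x y y≮x δ 0<δ with half δ 0<δ
... | η , 0<η , refl with half η 0<η
... | θ , 0<θ , refl with cauchy x θ 0<θ | cauchy y θ 0<θ
... | N , x-near | N′ , y-near = N ℕ.⊔ N′ , bound
  where
  M = N ℕ.⊔ N′

  regroup : ∀ q r → q ℚ.+ r ℚ.+ (r ℚ.+ r) ℚ.+ r ≡ q ℚ.+ ((r ℚ.+ r) ℚ.+ (r ℚ.+ r))
  regroup = solve 2 (λ q r → q :+ r :+ (r :+ r) :+ r := q :+ ((r :+ r) :+ (r :+ r))) refl
    where open +-*-Solver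

  bound : ∀ n → M ℕ.≤ n → seq x n ℚ.≤ seq y n ℚ.+ δ
  bound n M≤n with seq x n ℚₚ.≤? seq y n ℚ.+ δ
  ... | yes x≤y+δ = x≤y+δ
  ... | no x≰y+δ = ⊥-elim (y≮x (η , 0<η , M , gap))
    where
    gap : ∀ m → M ℕ.≤ m → seq y m ℚ.+ η ℚ.≤ seq x m
    gap m M≤m = +-cancelʳ-≤ θ (begin
      seq y m ℚ.+ η ℚ.+ θ           ≤⟨ ℚₚ.+-monoˡ-≤ θ (ℚₚ.+-monoˡ-≤ η
                                         (∣p-q∣<r⇒p≤q+r (seq y m) (seq y n)
                                           (y-near m n (N′≤ M≤m) (N′≤ M≤n)))) ⟩
      seq y n ℚ.+ θ ℚ.+ η ℚ.+ θ     ≡⟨ regroup (seq y n) θ ⟩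
      seq y n ℚ.+ δ                 ≤⟨ ℚₚ.<⇒≤ (ℚₚ.≰⇒> x≰y+δ) ⟩
      seq x n                       ≤⟨ ∣p-q∣<r⇒p≤q+r (seq x n) (seq x m)
                                         (x-near n m (N≤ M≤n) (N≤ M≤m)) ⟩
      seq x m ℚ.+ θ                 ∎)
      where
      open ℚₚ.≤-Reasoning
      N≤ : ∀ {k} → M ℕ.≤ k → N ℕ.≤ k
      N≤ = ℕₚ.≤-trans (ℕₚ.m≤m⊔n N N′)
      N′≤ : ∀ {k} → M ℕ.≤ k → N′ ℕ.≤ k
      N′≤ = ℕₚ.≤-trans (ℕₚ.m≤n⊔m N N′)

<ᴿ-irrefl : ∀ x → ¬ (x <ᴿ x)
<ᴿ-irrefl x = ≤ᴿ⇒≯ᴿ x x λ δ 0<δ → 0 , λ n _ → ℚₚ.<⇒≤ (0<q⇒p<p+q (seq x n) 0<δ)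

-- Pointwise equality suffices for the rearrangements of sums below, and it lets the same gap and
-- threshold serve again.
<ᴿ-resp-≗ : ∀ x x′ y y′ → (∀ n → seq x n ≡ seq x′ n) → (∀ n → seq y n ≡ seq y′ n) →
  x <ᴿ y → x′ <ᴿ y′
<ᴿ-resp-≗ _ _ _ _ x≗x′ y≗y′ (δ , 0<δ , N , x+δ≤y) = δ , 0<δ , N , λ n N≤n →
  subst₂ ℚ._≤_ (cong (ℚ._+ δ) (x≗x′ n)) (y≗y′ n) (x+δ≤y n N≤n)

+ᴿ-comm : ∀ x y n → seq (x +ᴿ y) n ≡ seq (y +ᴿ x) n
+ᴿ-comm x y n = ℚₚ.+-comm (seq x n) (seq y n)

fromℕ-mono-< : ∀ {a b} → a ℕ.< b → fromℕ a <ᴿ fromℕ b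
-- Distinct naturals differ by at least 1, hence the gap `1ℚ` from index 0 on.
fromℕ-mono-< {a} {b} a<b = 1ℚ , toWitness {a? = 0ℚ ℚₚ.<? 1ℚ} _ , 0 , λ _ _ →
  subst (ℚ._≤ ℤ.+ b ℚ./ 1)
    (sym (trans (fromℕ-homo-+ a 1) (cong (λ k → ℤ.+ k ℚ./ 1) (ℕₚ.+-comm a 1))))
    (fromℕ-mono-≤ a<b)

≃-refl : ∀ x → x ≃ x
≃-refl x δ 0<δ = 0 , λ n _ → subst (ℚ._< δ) (sym (cong ℚ.∣_∣ (ℚₚ.+-inverseʳ (seq x n)))) 0<δ

-- Comparing differences of reals.

-- A pair (p , q) stands for the real number p - q.
_≺_ : Rel (ℝ × ℝ) 0ℓ
(p , q) ≺ (p′ , q′) = p +ᴿ q′ <ᴿ p′ +ᴿ q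

≺-irrefl : Irreflexive _≡_ _≺_
≺-irrefl {p , q} refl = <ᴿ-irrefl (p +ᴿ q)

-- The two inequalities are added and `p′ + q′` is cancelled. The gap `δ` of the first survives;
-- that of the second is dropped.
≺-trans : Transitive _≺_
≺-trans {p , q} {p′ , q′} {p″ , q″} (δ , 0<δ , N , lt) (δ′ , 0<δ′ , N′ , lt′) =
  δ , 0<δ , N ℕ.⊔ N′ , λ n N≤n → +-cancelʳ-≤ (seq p′ n ℚ.+ seq q′ n)
    (subst₂ ℚ._≤_
      (regroupˡ (seq p n) (seq q′ n) (seq p′ n) (seq q″ n) δ)
      (regroupʳ (seq p′ n) (seq q n) (seq p″ n) (seq q′ n))
      (ℚₚ.+-mono-≤ (lt n (ℕₚ.≤-trans (ℕₚ.m≤m⊔n N N′) N≤n))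
        (ℚₚ.≤-trans (ℚₚ.<⇒≤ (0<q⇒p<p+q _ 0<δ′)) (lt′ n (ℕₚ.≤-trans (ℕₚ.m≤n⊔m N N′) N≤n)))))
  where
  open +-*-Solver
  regroupˡ : ∀ p q′ p′ q″ δ →
    p ℚ.+ q′ ℚ.+ δ ℚ.+ (p′ ℚ.+ q″) ≡ p ℚ.+ q″ ℚ.+ δ ℚ.+ (p′ ℚ.+ q′)
  regroupˡ = solve 5 (λ p q′ p′ q″ δ →
    p :+ q′ :+ δ :+ (p′ :+ q″) := p :+ q″ :+ δ :+ (p′ :+ q′)) refl
  regroupʳ : ∀ p′ q p″ q′ → p′ ℚ.+ q ℚ.+ (p″ ℚ.+ q′) ≡ p″ ℚ.+ q ℚ.+ (p′ ℚ.+ q′)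
  regroupʳ = solve 4 (λ p′ q p″ q′ →
    p′ :+ q :+ (p″ :+ q′) := p″ :+ q :+ (p′ :+ q′)) refl

-- Paths in the layered graph.

module _ (em : ExcludedMiddle 0ℓ) (n₁ n₃ : ℕ) (G : ThreeLayeredDAG n₁ 2 n₃) where
  open ThreeLayeredDAG G

  -- By contraposition: a path lighter than `π` under `w` would also be lighter under `w′`, where
  -- `π` is shortest. Nothing is demanded of ties under `w`.
  strict⇒preserver : ∀ w w′ →
    (∀ {u v} (π π′ : Path u v) →
      pathWeight w π′ <ᴿ pathWeight w π → pathWeight w′ π′ <ᴿ pathWeight w′ π) →
    IsPreserver w w′
  strict⇒preserver w w′ strict π π-shortest π′ =
    ≯ᴿ⇒≤ᴿ (pathWeight w π) (pathWeight w π′) λ π′<π →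
      ≤ᴿ⇒≯ᴿ (pathWeight w′ π) (pathWeight w′ π′) (π-shortest π′) (strict π π′ π′<π)

  -- A view of paths by length. A second edge already ends in the last layer, so there is never a
  -- third, and a two-edge path has its endpoints in the outer layers.
  data Route : ∀ {u v} → Path u v → Set where
    empty : ∀ {u} → Route {u} ε
    edge  : ∀ {u v} (e : Edge u v) → Route (e ◅ ε)
    via   : ∀ s m t (e : Edge (inj₁ s) (inj₂ (inj₁ m))) (e′ : Edge (inj₂ (inj₁ m)) (inj₂ (inj₂ t))) →
            Route (e ◅ e′ ◅ ε)

  route : ∀ {u v} (π : Path u v) → Route π
  route ε       = empty
  route (e ◅ ε) = edge e
  route (e ◅ e′ ◅ ε) with layered _ _ e | layered _ _ e′
  ... | V₁→V₂ s m | V₂→V₃ .m t = via s m t e e′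
  route (e ◅ e′ ◅ e″ ◅ π) with layered _ _ e | layered _ _ e′ | layered _ _ e″
  ... | V₁→V₂ s m | V₂→V₃ .m t | ()

  -- The weighting by ranks.

  module _ (w : Weighting) where

    -- Junk value 0 on non-edges; only its values on edges matter.
    weight₀ : Vertex → Vertex → ℝ
    weight₀ u v with T? (adj u v)
    ... | yes e = weight w u v e
    ... | no _  = 0ᴿ

    weight≡weight₀ : ∀ u v e → weight w u v e ≡ weight₀ u v
    weight≡weight₀ u v e with T? (adj u v)
    ... | yes e′ = cong (weight w u v) (T-irrelevant e e′)
    ... | no ¬e  = ⊥-elim (¬e e)

    a b : Vertex
    a = inj₂ (inj₁ zero)
    b = inj₂ (inj₁ (suc zero))

    -- `a` and `b` swap roles at a sink, so that `key (inj₁ s) ≺ key (inj₂ t)` says that the route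
    -- through `a` is lighter. Junk values may enter a key and the ranks, but when both routes exist
    -- their comparison reads only true weights.
    key : Fin n₁ ⊎ Fin n₃ → ℝ × ℝ
    key (inj₁ s) = weight₀ (inj₁ s) a , weight₀ (inj₁ s) b
    key (inj₂ t) = weight₀ b (inj₂ (inj₂ t)) , weight₀ a (inj₂ (inj₂ t))

    -- Excluded middle decides `≺` on reals, which counting requires. Sources and sinks are
    -- enumerated together, so their ranks are comparable.
    open Rank {_≺_ = _≺_} (λ {x} {y} → ≺-irrefl {x} {y}) (λ {x} {y} {z} → ≺-trans {x} {y} {z})
      (λ x y → em {x ≺ y}) (λ i → key (splitAt n₁ i))

    rank-key-strict : ∀ x y → key x ≺ key y → rank (key x) ℕ.< rank (key y)
    rank-key-strict x y x≺y = subst (λ z → rank (key z) ℕ.< rank (key y)) x≡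
      (rank-strict (join n₁ n₃ x) {key y} (subst (λ z → key z ≺ key y) (sym x≡) x≺y))
      where
      x≡ : splitAt n₁ (join n₁ n₃ x) ≡ x
      x≡ = splitAt-join n₁ n₃ x

    rankWeight : Vertex → Vertex → ℕ
    rankWeight (inj₁ s) (inj₂ (inj₁ zero))              = 1 + rank (key (inj₁ s))
    rankWeight (inj₂ (inj₁ (suc zero))) (inj₂ (inj₂ t)) = 1 + rank (key (inj₂ t))
    rankWeight _ _                                      = 1

    -- A rank counts some of `n₁ + n₃` keys and may be 0; the added 1 makes the weight positive and
    -- accounts for the last summand of the upper bound.
    1≤rankWeight≤n₁+n₃+1 : ∀ {u v} → NextLayer u v →
      1 ℕ.≤ rankWeight u v × rankWeight u v ℕ.≤ n₁ + n₃ + 1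
    1≤rankWeight≤n₁+n₃+1 = λ where
        (V₁→V₂ s zero)       → bounds _ (rank≤n (key (inj₁ s)))
        (V₁→V₂ s (suc zero)) → bounds 0 ℕ.z≤n
        (V₂→V₃ zero t)       → bounds 0 ℕ.z≤n
        (V₂→V₃ (suc zero) t) → bounds _ (rank≤n (key (inj₂ t)))
      where
      bounds : ∀ k → k ℕ.≤ n₁ + n₃ → 1 ℕ.≤ 1 + k × 1 + k ℕ.≤ n₁ + n₃ + 1
      bounds k k≤ = ℕ.s≤s ℕ.z≤n , subst (1 + k ℕ.≤_) (ℕₚ.+-comm 1 (n₁ + n₃)) (ℕ.s≤s k≤)

    rankWeighting : Weighting
    weight   rankWeighting u v _ = fromℕ (rankWeight u v)
    positive rankWeighting u v e = fromℕ-mono-< (proj₁ (1≤rankWeight≤n₁+n₃+1 (layered u v e)))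

    two-edge-weight₀ : ∀ {u v x} (e : Edge u v) (f : Edge v x) n →
      seq (pathWeight w (e ◅ f ◅ ε)) n ≡ seq (weight₀ u v +ᴿ weight₀ v x) n
    two-edge-weight₀ {u} {v} {x} e f n = cong₂ ℚ._+_
      (cong (λ r → seq r n) (weight≡weight₀ u v e))
      (trans (ℚₚ.+-identityʳ _) (cong (λ r → seq r n) (weight≡weight₀ v x f)))

    two-edge-rankWeight : ∀ {u v x} (e : Edge u v) (f : Edge v x) n →
      seq (fromℕ (rankWeight u v + rankWeight v x)) n ≡ seq (pathWeight rankWeighting (e ◅ f ◅ ε)) n
    two-edge-rankWeight {u} {v} {x} e f n = sym (trans
      (cong (seq (fromℕ (rankWeight u v)) n ℚ.+_) (ℚₚ.+-identityʳ _))
      (fromℕ-homo-+ (rankWeight u v) (rankWeight v x)))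

    module _ {u v v′ x} (e : Edge u v) (f : Edge v x) (e′ : Edge u v′) (f′ : Edge v′ x) where

      two-edge-<ᴿ⇒weight₀ : pathWeight w (e ◅ f ◅ ε) <ᴿ pathWeight w (e′ ◅ f′ ◅ ε) →
        weight₀ u v +ᴿ weight₀ v x <ᴿ weight₀ u v′ +ᴿ weight₀ v′ x
      two-edge-<ᴿ⇒weight₀ = <ᴿ-resp-≗
        (pathWeight w (e ◅ f ◅ ε)) (weight₀ u v +ᴿ weight₀ v x)
        (pathWeight w (e′ ◅ f′ ◅ ε)) (weight₀ u v′ +ᴿ weight₀ v′ x)
        (two-edge-weight₀ e f) (two-edge-weight₀ e′ f′)

      rankWeight⇒two-edge-<ᴿ :
        rankWeight u v + rankWeight v x ℕ.< rankWeight u v′ + rankWeight v′ x →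
        pathWeight rankWeighting (e ◅ f ◅ ε) <ᴿ pathWeight rankWeighting (e′ ◅ f′ ◅ ε)
      rankWeight⇒two-edge-<ᴿ lt = <ᴿ-resp-≗
        (fromℕ (rankWeight u v + rankWeight v x)) (pathWeight rankWeighting (e ◅ f ◅ ε))
        (fromℕ (rankWeight u v′ + rankWeight v′ x)) (pathWeight rankWeighting (e′ ◅ f′ ◅ ε))
        (two-edge-rankWeight e f) (two-edge-rankWeight e′ f′) (fromℕ-mono-< lt)

    module _ (s : Fin n₁) (t : Fin n₃) where

      u v : Vertex
      u = inj₁ s
      v = inj₂ (inj₂ t)

      -- In the new weights the route through `a` costs 2 plus the rank of `s`, and the one through
      -- `b` costs 2 plus the rank of `t`. Up to commuting one sum, the hypothesis is
      -- `key (inj₁ s) ≺ key (inj₂ t)`.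
      via-a<via-b : weight₀ u a +ᴿ weight₀ a v <ᴿ weight₀ u b +ᴿ weight₀ b v →
        rankWeight u a + rankWeight a v ℕ.< rankWeight u b + rankWeight b v
      via-a<via-b lt = subst (ℕ._< rankWeight u b + rankWeight b v)
        (ℕₚ.+-comm 1 (rankWeight u a))
        (ℕ.s≤s (ℕ.s≤s (rank-key-strict (inj₁ s) (inj₂ t)
          (<ᴿ-resp-≗ (weight₀ u a +ᴿ weight₀ a v) (weight₀ u a +ᴿ weight₀ a v)
            (weight₀ u b +ᴿ weight₀ b v) (weight₀ b v +ᴿ weight₀ u b)
            (λ _ → refl) (+ᴿ-comm (weight₀ u b) (weight₀ b v)) lt))))

      via-b<via-a : weight₀ u b +ᴿ weight₀ b v <ᴿ weight₀ u a +ᴿ weight₀ a v →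
        rankWeight u b + rankWeight b v ℕ.< rankWeight u a + rankWeight a v
      via-b<via-a lt = subst (rankWeight u b + rankWeight b v ℕ.<_)
        (ℕₚ.+-comm 1 (rankWeight u a))
        (ℕ.s≤s (ℕ.s≤s (rank-key-strict (inj₂ t) (inj₁ s)
          (<ᴿ-resp-≗ (weight₀ u b +ᴿ weight₀ b v) (weight₀ b v +ᴿ weight₀ u b)
            (weight₀ u a +ᴿ weight₀ a v) (weight₀ u a +ᴿ weight₀ a v)
            (+ᴿ-comm (weight₀ u b) (weight₀ b v)) (λ _ → refl) lt))))

      rankWeight-strict : ∀ m m′ → let c = inj₂ (inj₁ m) ; c′ = inj₂ (inj₁ m′) in
        weight₀ u c +ᴿ weight₀ c v <ᴿ weight₀ u c′ +ᴿ weight₀ c′ v →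
        rankWeight u c + rankWeight c v ℕ.< rankWeight u c′ + rankWeight c′ v
      rankWeight-strict zero       zero       lt = ⊥-elim (<ᴿ-irrefl (weight₀ u a +ᴿ weight₀ a v) lt)
      rankWeight-strict zero       (suc zero) lt = via-a<via-b lt
      rankWeight-strict (suc zero) zero       lt = via-b<via-a lt
      rankWeight-strict (suc zero) (suc zero) lt = ⊥-elim (<ᴿ-irrefl (weight₀ u b +ᴿ weight₀ b v) lt)

    -- Layering makes two paths with common endpoints equally long: no edge is a loop or skips the
    -- middle layer. Empty paths coincide, and so do single edges since `T` has at most one proof;
    -- only two-edge routes with the same `s` and `t` can differ in weight.
    rankWeighting-strict : ∀ {u v} (π π′ : Path u v) →
      pathWeight w π′ <ᴿ pathWeight w π →
      pathWeight rankWeighting π′ <ᴿ pathWeight rankWeighting π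
    rankWeighting-strict {u} {v} π π′ lt with route π | route π′
    ... | empty | empty = ⊥-elim (<ᴿ-irrefl 0ᴿ lt)
    ... | empty | edge e with () ← layered u u e
    ... | edge e | empty with () ← layered u u e
    ... | edge e | edge e′ rewrite T-irrelevant e e′ =
      ⊥-elim (<ᴿ-irrefl (pathWeight w (e′ ◅ ε)) lt)
    ... | edge e | via _ _ _ _ _ with () ← layered u v e
    ... | via _ _ _ _ _ | edge e with () ← layered u v e
    ... | via s m t e f | via .s m′ .t e′ f′ =
      rankWeight⇒two-edge-<ᴿ e′ f′ e f
        (rankWeight-strict s t m′ m (two-edge-<ᴿ⇒weight₀ e′ f′ e f lt))

theorem1p7 : ExcludedMiddle 0ℓ →
    ∀ (n₁ n₃ : ℕ) (G : ThreeLayeredDAG n₁ 2 n₃) → let open ThreeLayeredDAG G in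
    (w : Weighting) →
    ∃[ w-H ] (IsPreserver w w-H × IntegerWeightsIn[1, n₁ + n₃ + 1 ] w-H)
theorem1p7 em n₁ n₃ G w =
    rankWeighting em n₁ n₃ G w
  , strict⇒preserver em n₁ n₃ G w _ (rankWeighting-strict em n₁ n₃ G w)
  , λ u v e → let (1≤k , k≤M) = 1≤rankWeight≤n₁+n₃+1 em n₁ n₃ G w (layered u v e) in
      rankWeight em n₁ n₃ G w u v , 1≤k , k≤M , ≃-refl (fromℕ (rankWeight em n₁ n₃ G w u v))
  where open ThreeLayeredDAG G
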